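{- A connected monounary algebra is ultrahomogeneous if and only if it is isomorphic to either $\mathcal{B}_\alpha$ for some nonzero cardinal $\alpha$, or to $\mathcal{A}[n;\alpha_0,\alpha_1,\dots]$ for some $n\in\mathbb{N}$ and some (possibly finite, possibly empty) countable list of nonzero cardinals $\alpha_0,\alpha_1,\dots$.
   Context: A monounary algebra is a pair $\mathcal{A}=(A;\theta)$ where $A$ is a nonempty set (of arbitrary cardinality) and $\theta\colon A\to A$. It is connected if for all $x,y\in A$ there are $n,m\geq 0$ with $\theta^n(x)=\theta^m(y)$. Subalgebras are nonempty subsets closed under $\theta$; isomorphisms are bijections commuting with the operations. $\mathcal{A}$ is ultrahomogeneous if every isomorphism between finitely generated subalgebras of $\mathcal{A}$ extends to an automorphism of $\mathcal{A}$. $\mathbb{N}=\{1,2,\dots\}$. An element $x$ is cyclic if $\theta^n(x)=x$ for some $n\in\mathbb{N}$. The height $\mathrm{ht}(x)$ is the least $n\geq 0$ with $\theta^n(x)$ cyclic ($\infty$ if there is none). For a cardinal $\alpha>0$, $\mathcal{B}_\alpha$ denotes the (unique up to isomorphism) connected monounary algebra without cyclic elements in which $|\theta^{ -1}(x)|=\alpha$ for every element $x$. For $n\in\mathbb{N}$ and a (possibly finite) countable list $\alpha_0,\alpha_1,\dots$ of nonzero cardinals, $\mathcal{A}[n;\alpha_0,\alpha_1,\dots]$ denotes the (unique up to isomorphism) connected monounary algebra whose set $C$ of cyclic elements has size $n$, with $|\theta^{ -1}(c)\setminus C|=\alpha_0$ for each $c\in C$, and $|\theta^{ -1}(x)|=\alpha_k$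 for every $x$ with $\mathrm{ht}(x)=k>0$. If the list is finite, missing entries are read as $0$ (so with list $\alpha_0,\dots,\alpha_h$ the elements of height $h+1$ have no preimages, and with the empty list the algebra is just an $n$-cycle). -}

module Defs where

open import Level using (Level) renaming (suc to lsuc)
open import Algebra.Core using (Op₁)
open import Algebra.Morphism.Definitions using (Homomorphic₁)
open import Data.Empty.Polymorphic using (⊥)
open import Data.Fin.Base using (Fin)
open import Data.Irrelevant as Irrelevant using ()
open import Data.List.Base using (List; []; _∷_)
open import Data.List.Membership.Propositional renaming (_∈_ to _∈ˡ_) using ()
open import Data.Nat.Base using (ℕ; zero; suc; _<_; _>_; _≥_)
open import Data.Product.Base using (Σ-syntax; ∃-syntax; _×_; _,_; proj₁; proj₂)
open import Data.Refinement.Base using (Refinement-syntax; value; _,_)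
open import Function.Bundles using (_↔_; module Inverse)
open import Relation.Binary.PropositionalEquality.Core using (_≡_)
open import Relation.Nullary.Negation.Core using (¬_)
open import Relation.Unary using (Pred; _∈_; _≐_; Satisfiable)

private
  variable
    ℓ : Level

-- `nonempty` only witnesses that the carrier is inhabited: it is not part of
-- the signature, and isomorphisms need not preserve it.
record MonounaryAlgebra (ℓ : Level) : Set (lsuc ℓ) where
  field
    Carrier  : Set ℓ
    θ        : Op₁ Carrier
    nonempty : Carrier

  -- (θ ^ n) x is θⁿ(x), with θ ^ 0 the identity.
  open import Function.Endo.Propositional Carrier using (_^_) public

  Connected : Set ℓ
  Connected = ∀ x y → ∃[ n ] ∃[ m ] (θ ^ n) x ≡ (θ ^ m) y

  Cyclic : Pred Carrier ℓ
  Cyclic x = ∃[ n ] n ≥ 1 × (θ ^ n) x ≡ x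

  -- ht(x) = k for a finite k; ht(x) = ∞ means that no k qualifies.
  HasHeight : Carrier → ℕ → Set ℓ
  HasHeight x k = Cyclic ((θ ^ k) x) × (∀ j → j < k → ¬ Cyclic ((θ ^ j) x))

  -- Subsets are taken as types with irrelevant membership proofs, so that
  -- their elements are equal exactly when the underlying elements are, and
  -- bijections with them count elements rather than proofs.
  CyclicElements : Set ℓ
  CyclicElements = [ x ∈ Carrier ∣ Cyclic x ]

  Preimage : Carrier → Set ℓ
  Preimage x = [ y ∈ Carrier ∣ θ y ≡ x ]

  NoncyclicPreimage : Carrier → Set ℓ
  NoncyclicPreimage x = [ y ∈ Carrier ∣ (θ y ≡ x × ¬ Cyclic y) ]

  data ⟨_⟩ (X : Pred Carrier ℓ) : Pred Carrier ℓ where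
    base : ∀ {x} → x ∈ X → x ∈ ⟨ X ⟩
    step : ∀ {x} → x ∈ ⟨ X ⟩ → θ x ∈ ⟨ X ⟩

open MonounaryAlgebra using (Carrier; θ)

infix 4 _≅_

record _≅_ (𝒜 ℬ : MonounaryAlgebra ℓ) : Set ℓ where
  field
    bijection : Carrier 𝒜 ↔ Carrier ℬ

  open Inverse bijection public using (to; from)

  field
    homo : Homomorphic₁ (Carrier 𝒜) (Carrier ℬ) _≡_ to (θ 𝒜) (θ ℬ)

open _≅_ using (to)

record Subalgebra (𝒜 : MonounaryAlgebra ℓ) : Set (lsuc ℓ) where
  field
    member    : Pred (Carrier 𝒜) ℓ
    inhabited : Satisfiable member
    closed    : ∀ {x} → x ∈ member → θ 𝒜 x ∈ member

  algebra : MonounaryAlgebra ℓ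
  algebra = record
    { Carrier  = [ x ∈ Carrier 𝒜 ∣ x ∈ member ]
    ; θ        = λ (x , x∈S) → θ 𝒜 x , Irrelevant.map closed x∈S
    ; nonempty = proj₁ inhabited , Irrelevant.pure (proj₂ inhabited)
    }

  FinitelyGenerated : Set ℓ
  FinitelyGenerated = ∃[ xs ] member ≐ MonounaryAlgebra.⟨_⟩ 𝒜 (_∈ˡ xs)

open Subalgebra using (algebra; FinitelyGenerated)

Ultrahomogeneous : MonounaryAlgebra ℓ → Set (lsuc ℓ)
Ultrahomogeneous 𝒜 =
  (S T : Subalgebra 𝒜) → FinitelyGenerated S → FinitelyGenerated T →
  (f : algebra S ≅ algebra T) →
  Σ[ g ∈ 𝒜 ≅ 𝒜 ] (∀ x → to g (value x) ≡ value (to f x))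

-- Cardinals are represented by types, and |X| = α by a bijection X ↔ α.
record NonzeroCardinal (ℓ : Level) : Set (lsuc ℓ) where
  field
    ∣_∣     : Set ℓ
    nonzero : ∣_∣

open NonzeroCardinal public using (∣_∣)

data CardinalList (ℓ : Level) : Set (lsuc ℓ) where
  finite   : List (NonzeroCardinal ℓ) → CardinalList ℓ
  infinite : (ℕ → NonzeroCardinal ℓ)  → CardinalList ℓ

-- The k-th entry αₖ, read as 0 when it is missing.
entry : CardinalList ℓ → ℕ → Set ℓ
entry (finite [])       k       = ⊥
entry (finite (α ∷ αs)) zero    = ∣ α ∣
entry (finite (α ∷ αs)) (suc k) = entry (finite αs) k
entry (infinite α)      k       = ∣ α k ∣

-- 𝓑_α and 𝓐[n; α₀, α₁, …] are specified only up to isomorphism, so they are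
-- given by the properties which determine them up to isomorphism.
record Is𝓑 (α : NonzeroCardinal ℓ) (ℬ : MonounaryAlgebra ℓ) : Set ℓ where
  open MonounaryAlgebra ℬ using (Connected; Cyclic; Preimage)
  field
    connected  : Connected
    noncyclic  : ∀ x → ¬ Cyclic x
    ∣preimage∣ : ∀ x → Preimage x ↔ ∣ α ∣

record Is𝓐[_⨾_] (n : ℕ) (α : CardinalList ℓ) (ℬ : MonounaryAlgebra ℓ) : Set ℓ where
  open MonounaryAlgebra ℬ
    using (Connected; Cyclic; HasHeight; CyclicElements; Preimage; NoncyclicPreimage)
  field
    connected           : Connected
    ∣cyclic∣            : CyclicElements ↔ Fin n
    ∣noncyclicPreimage∣ : ∀ c → Cyclic c → NoncyclicPreimage c ↔ entry α 0
    ∣preimage∣          : ∀ x k → k > 0 → HasHeight x k → Preimage x ↔ entry α k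

{-# OPTIONS --safe #-}

-- A connected algebra is ultrahomogeneous iff any two elements of the same
-- height have equally many preimages.  If x and y have the same height, then
-- the subalgebras they generate are isomorphic, and an automorphism taking x
-- to y matches their preimages.  Conversely, let f : S ≅ T with S finitely
-- generated.  Then S meets each θ⁻¹(u) in a finite set, so the partial map
-- given by f on θ⁻¹(u) extends to a bijection θ⁻¹(u) ↔ θ⁻¹(v), where v is the
-- image of u.  As S contains all cyclic elements, these bijections preserve
-- heights, so f can be extended upwards, level by level above S.
module Submission where

open import Defs
open import Axiom.ExcludedMiddle using (ExcludedMiddle)
open import Data.Nat.Base using (_≥_)
open import Data.Product.Base using (∃-syntax; _×_)
open import Data.Sum.Base using (_⊎_)
open import Function.Bundles using (_⇔_)

open import Data.Empty using (⊥-elim)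
import Data.Empty.Polymorphic as Polymorphic
open import Data.Fin.Base using (Fin; fromℕ<; toℕ)
open import Data.Fin.Properties using (toℕ<n; toℕ-fromℕ<; toℕ-injective)
open import Data.Irrelevant using ([_])
open import Data.List.Base using (List; []; _∷_; _++_; applyUpTo)
open import Data.List.Membership.Propositional using () renaming (_∈_ to _∈ˡ_)
open import Data.List.Membership.Propositional.Properties using (∈-++⁺ˡ; ∈-++⁺ʳ)
open import Data.List.Relation.Unary.Any using (here; there)
open import Data.Nat.Base using (ℕ; zero; suc; _+_; _*_; _∸_; _≤_; _<_; z≤n; s≤s; NonZero; >-nonZero)
open import Data.Nat.DivMod using (_%_; _/_; m≡m%n+[m/n]*n; m%n<n)
open import Data.Nat.Properties
open import Data.Product.Base using (Σ-syntax; _,_; proj₁; proj₂)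
open import Data.Refinement.Base as Refinement using (Refinement; value; _,_)
open import Data.Refinement.Properties using (value-injective)
open import Data.Sum.Base using (inj₁; inj₂; [_,_]′)
open import Data.Sum.Function.Propositional using (_⊎-↔_)
open import Data.Unit.Base using (⊤)
open import Function.Base using (_∘_; id)
open import Function.Bundles using (_↔_; mk↔ₛ′; mk⇔; module Inverse; module Equivalence)
open import Function.Construct.Composition using (_↔-∘_)
open import Function.Construct.Identity using (↔-id)
open import Function.Construct.Symmetry using (↔-sym; ⇔-sym)
open import Function.Definitions using (Injective; StrictlySurjective)
open import Level using (Level)
open import Relation.Binary.Definitions using (DecidableEquality; tri<; tri≈; tri>)
open import Relation.Binary.PropositionalEquality
  using (_≡_; _≢_; refl; sym; trans; cong; subst; subst₂; cong-app; module ≡-Reasoning)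
open import Relation.Nullary using (¬_; Dec; yes; no; contradiction)
open import Relation.Nullary.Decidable using (recompute; decidable-stable)
open import Relation.Unary using (Pred; Decidable; _∈_; _∉_)

private
  variable
    ℓ p q : Level

-- Bijections, least witnesses, list entries and transpositions.

injective∧surjective⇒↔ : {A : Set p} {B : Set q} (f : A → B) →
  Injective _≡_ _≡_ f → StrictlySurjective _≡_ f → A ↔ B
injective∧surjective⇒↔ f inj surj =
  mk↔ₛ′ f (proj₁ ∘ surj) (proj₂ ∘ surj) (λ x → inj (proj₂ (surj (f x))))

↔-injective : {A : Set p} {B : Set q} (f : A ↔ B) → Injective _≡_ _≡_ (Inverse.to f)
↔-injective f {x} {y} eq =
  trans (sym (Inverse.strictlyInverseʳ f x))
    (trans (cong (Inverse.from f) eq) (Inverse.strictlyInverseʳ f y))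

refinement-↔ : {A B : Set p} {P : Pred A q} {Q : Pred B q} (f : A ↔ B) →
  (∀ x → P x ⇔ Q (Inverse.to f x)) → Refinement A P ↔ Refinement B Q
refinement-↔ {Q = Q} f P⇔Q = mk↔ₛ′
  (Refinement.map to (λ {x} → Equivalence.to (P⇔Q x)))
  (Refinement.map from (λ {y} Qy →
    Equivalence.from (P⇔Q (from y)) (subst Q (sym (strictlyInverseˡ y)) Qy)))
  (λ y → value-injective (strictlyInverseˡ (value y)))
  (λ x → value-injective (strictlyInverseʳ (value x)))
  where open Inverse f

least : {P : Pred ℕ p} → Decidable P → ∀ n → P n →
  ∃[ m ] P m × (∀ j → j < m → ¬ P j)
least P? zero    Pn = 0 , Pn , λ _ ()
least P? (suc n) Pn with P? 0
... | yes P0 = 0 , P0 , λ _ ()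
... | no ¬P0 =
  let m , Pm , min = least (P? ∘ suc) n Pn
  in suc m , Pm , λ { zero _ → ¬P0 ; (suc j) (s≤s j<m) → min j j<m }

entry-applyUpTo-< : ∀ (α : ℕ → NonzeroCardinal ℓ) {k n} → k < n →
  entry (finite (applyUpTo α n)) k ≡ ∣ α k ∣
entry-applyUpTo-< α {zero}  (s≤s _)   = refl
entry-applyUpTo-< α {suc k} (s≤s k<n) = entry-applyUpTo-< (α ∘ suc) k<n

entry-applyUpTo-≥ : ∀ (α : ℕ → NonzeroCardinal ℓ) {k n} → n ≤ k →
  entry (finite (applyUpTo α n)) k ≡ Polymorphic.⊥
entry-applyUpTo-≥ α z≤n       = refl
entry-applyUpTo-≥ α (s≤s n≤k) = entry-applyUpTo-≥ (α ∘ suc) n≤k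

module Transposition {A : Set p} (_≟_ : DecidableEquality A) (a b : A) where

  transpose : A → A
  transpose x with x ≟ a | x ≟ b
  ... | yes _ | _     = b
  ... | no _  | yes _ = a
  ... | no _  | no _  = x

  transpose-left : ∀ {x} → x ≡ a → transpose x ≡ b
  transpose-left {x} x≡a with x ≟ a | x ≟ b
  ... | yes _  | _ = refl
  ... | no x≢a | _ = contradiction x≡a x≢a

  transpose-right : ∀ {x} → x ≡ b → transpose x ≡ a
  transpose-right {x} x≡b with x ≟ a | x ≟ b
  ... | yes x≡a | _     = trans (sym x≡b) x≡a
  ... | no _    | yes _ = refl
  ... | no _    | no x≢b = contradiction x≡b x≢b

  transpose-other : ∀ {x} → x ≢ a → x ≢ b → transpose x ≡ x
  transpose-other {x} x≢a x≢b with x ≟ a | x ≟ b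
  ... | yes x≡a | _       = contradiction x≡a x≢a
  ... | no _    | yes x≡b = contradiction x≡b x≢b
  ... | no _    | no _    = refl

  transpose-involutive : ∀ x → transpose (transpose x) ≡ x
  transpose-involutive x with x ≟ a | x ≟ b
  ... | yes x≡a | _       = trans (transpose-right refl) (sym x≡a)
  ... | no _    | yes x≡b = trans (transpose-left refl) (sym x≡b)
  ... | no x≢a  | no x≢b  = transpose-other x≢a x≢b

  transpose-↔ : A ↔ A
  transpose-↔ = mk↔ₛ′ transpose transpose transpose-involutive transpose-involutive

open MonounaryAlgebra using (Carrier; θ)

≅-refl : {𝒜 : MonounaryAlgebra ℓ} → 𝒜 ≅ 𝒜
≅-refl = record { bijection = ↔-id _ ; homo = λ _ → refl }

-- Iterates, cyclic elements and heights.

module Iterates (𝒜 : MonounaryAlgebra ℓ) where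
  open MonounaryAlgebra 𝒜 renaming (Carrier to A; θ to t)
  open import Function.Endo.Propositional A using (^-homo)

  infix 4 _∼_

  -- For elements of a connected algebra, x ∼ y says that ht(x) = ht(y).
  _∼_ : A → A → Set ℓ
  x ∼ y = ∀ k → Cyclic ((t ^ k) x) ⇔ Cyclic ((t ^ k) y)

  ^-+ : ∀ m n x → (t ^ (m + n)) x ≡ (t ^ m) ((t ^ n) x)
  ^-+ m n x = cong-app (^-homo t m n) x

  ^-θ : ∀ n x → (t ^ n) (t x) ≡ t ((t ^ n) x)
  ^-θ zero    x = refl
  ^-θ (suc n) x = cong t (^-θ n x)

  ^-swap : ∀ m n x → (t ^ m) ((t ^ n) x) ≡ (t ^ n) ((t ^ m) x)
  ^-swap m n x = trans (sym (^-+ m n x))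
    (trans (cong (λ k → (t ^ k) x) (+-comm m n)) (^-+ n m x))

  period-^ : ∀ n k {x} → (t ^ n) x ≡ x → (t ^ n) ((t ^ k) x) ≡ (t ^ k) x
  period-^ n k eq = trans (^-swap n k _) (cong (t ^ k) eq)

  period-* : ∀ k n {x} → (t ^ n) x ≡ x → (t ^ (k * n)) x ≡ x
  period-* zero    n eq = refl
  period-* (suc k) n eq =
    trans (^-+ n (k * n) _) (trans (cong (t ^ n) (period-* k n eq)) eq)

  cyclic-^ : ∀ k {x} → Cyclic x → Cyclic ((t ^ k) x)
  cyclic-^ k (n , n≥1 , eq) = n , n≥1 , period-^ n k eq

  -- `j * n` more steps make `j * suc n` in all, which is `j` full turns of the period `suc n`.
  cyclic-returns : ∀ j {x} → Cyclic x → ∃[ r ] (t ^ r) ((t ^ j) x) ≡ x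
  cyclic-returns j {x} (suc n , _ , eq) = j * n , (begin
    (t ^ (j * n)) ((t ^ j) x)  ≡⟨ ^-+ (j * n) j x ⟨
    (t ^ (j * n + j)) x        ≡⟨ cong (λ k → (t ^ k) x) (+-comm (j * n) j) ⟩
    (t ^ (j + j * n)) x        ≡⟨ cong (λ k → (t ^ k) x) (*-suc j n) ⟨
    (t ^ (j * suc n)) x        ≡⟨ period-* j (suc n) eq ⟩
    x                          ∎)
    where open ≡-Reasoning

  collision-cyclic : ∀ m d {x} → (t ^ m) x ≡ (t ^ (suc d + m)) x → Cyclic ((t ^ m) x)
  collision-cyclic m d eq = suc d , s≤s z≤n , trans (sym (^-+ (suc d) m _)) (sym eq)

  -- Cyclicity of an iterate of `x` is itself a coincidence between two iterates of `x`, so it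
  -- transfers with the kernel of the map taking `n` to `(t ^ n) x`.
  kernel⊆⇒cyclic : ∀ {x y} →
    (∀ m n → (t ^ m) x ≡ (t ^ n) x → (t ^ m) y ≡ (t ^ n) y) →
    ∀ k → Cyclic ((t ^ k) x) → Cyclic ((t ^ k) y)
  kernel⊆⇒cyclic ker k (n , n≥1 , eq) =
    n , n≥1 , trans (sym (^-+ n k _)) (ker (n + k) k (trans (^-+ n k _) eq))

  ∼-noncyclic : (∀ x → ¬ Cyclic x) → ∀ x y → x ∼ y
  ∼-noncyclic ¬cyc x y k = mk⇔ (⊥-elim ∘ ¬cyc _) (⊥-elim ∘ ¬cyc _)

  ∼-fromParents : ∀ {x y} → (Cyclic x ⇔ Cyclic y) → t x ∼ t y → x ∼ y
  ∼-fromParents x⇔y tx∼ty zero = x⇔y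
  ∼-fromParents {x} {y} x⇔y tx∼ty (suc k) =
    subst (λ z → Cyclic z ⇔ Cyclic (t ((t ^ k) y))) (^-θ k x)
      (subst (λ z → Cyclic ((t ^ k) (t x)) ⇔ Cyclic z) (^-θ k y) (tx∼ty k))

  -- Below exponent `k` neither iterate is cyclic; from `k` on both are.
  heights⇒∼ : ∀ {x y k} → HasHeight x k → HasHeight y k → x ∼ y
  heights⇒∼ {k = k} (cx , ¬cx) (cy , ¬cy) j with j <? k
  ... | yes j<k = mk⇔ (⊥-elim ∘ ¬cx j j<k) (⊥-elim ∘ ¬cy j j<k)
  ... | no  j≮k with m≤n⇒∃[o]m+o≡n (≮⇒≥ j≮k)
  ...   | o , refl = mk⇔ (λ _ → later cy) (λ _ → later cx)
    where
    later : ∀ {z} → Cyclic ((t ^ k) z) → Cyclic ((t ^ (k + o)) z)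
    later {z} c = subst Cyclic
      (trans (sym (^-+ o k z)) (cong (λ n → (t ^ n) z) (+-comm o k))) (cyclic-^ o c)

  ∼-height : ∀ {x y k} → x ∼ y → HasHeight x k → HasHeight y k
  ∼-height {k = k} x∼y (c , ¬c) =
    Equivalence.to (x∼y k) c , λ j j<k → ¬c j j<k ∘ Equivalence.from (x∼y j)

  cyclic⇒height0 : ∀ {x} → Cyclic x → HasHeight x 0
  cyclic⇒height0 c = c , λ _ ()

  height-θ : ∀ {x k} → HasHeight x (suc k) → HasHeight (t x) k
  height-θ {x} {k} (c , ¬c) = subst Cyclic (sym (^-θ k x)) c ,
    λ j j<k → ¬c (suc j) (s≤s j<k) ∘ subst Cyclic (^-θ j x)

  height-preimage : ∀ {x k} → HasHeight (t x) k → ¬ Cyclic x → HasHeight x (suc k)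
  height-preimage {x} {k} (c , ¬c) ¬cx = subst Cyclic (^-θ k x) c , λ where
    zero    _         → ¬cx
    (suc j) (s≤s j<k) → ¬c j j<k ∘ subst Cyclic (sym (^-θ j x))

  height-downward : ∀ d {x k} → HasHeight x (d + k) → ∃[ y ] HasHeight y k
  height-downward zero    h = _ , h
  height-downward (suc d) h = height-downward d (height-θ h)

  height-noncyclic : ∀ {x k} → HasHeight x (suc k) → ¬ Cyclic x
  height-noncyclic (_ , ¬c) = ¬c 0 (s≤s z≤n)

  -- Used like an accessibility proof for the path `x`, `t x`, and so on until it enters `P`: the
  -- next step is available only under `x ∉ P`. Recursion towards a subalgebra thereby becomes
  -- structural.
  data Reaches (P : Pred A ℓ) (x : A) : Set ℓ where
    reaches : (x ∉ P → Reaches P (t x)) → Reaches P x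

  ^⇒reaches : ∀ {P} n {x} → (t ^ n) x ∈ P → Reaches P x
  ^⇒reaches zero    Px = reaches (contradiction Px)
  ^⇒reaches {P} (suc n) Px = reaches λ _ → ^⇒reaches n (subst P (sym (^-θ n _)) Px)

  closed-^ : (S : Subalgebra 𝒜) → ∀ n {x} →
    x ∈ Subalgebra.member S → (t ^ n) x ∈ Subalgebra.member S
  closed-^ S zero    x∈S = x∈S
  closed-^ S (suc n) x∈S = Subalgebra.closed S (closed-^ S n x∈S)

  subalgebra-^ : (S : Subalgebra 𝒜) → ∀ n s →
    value ((MonounaryAlgebra._^_ (Subalgebra.algebra S) (θ (Subalgebra.algebra S)) n) s)
      ≡ (t ^ n) (value s)
  subalgebra-^ S zero    s = refl
  subalgebra-^ S (suc n) s = cong t (subalgebra-^ S n s)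

  -- The cycle of a connected algebra.

  module _ (connected : Connected) where

    -- The path of `x` meets that of `c` by connectedness, and going on round the cycle it arrives
    -- at `c`.
    reaches-cyclic : ∀ x {c} → Cyclic c → ∃[ m ] (t ^ m) x ≡ c
    reaches-cyclic x {c} cyc =
      let m , n , eq = connected x c
          r , ret    = cyclic-returns n cyc
      in r + m , trans (^-+ r m x) (trans (cong (t ^ r) eq) ret)

    -- Every cyclic element lies on the path of `c`, and periods pass along paths.
    common-period : ∀ n {c d} → Cyclic d → (t ^ n) c ≡ c → (t ^ n) d ≡ d
    common-period n {c} cyc eq with reaches-cyclic c cyc
    ... | m , refl = period-^ n m eq

    -- By `common-period` both elements return after the same `suc n` steps, so applying `t ^ n` to
    -- the equation recovers them.
    θ-injective-cyclic : ∀ {c d} → Cyclic c → Cyclic d → t c ≡ t d → c ≡ d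
    θ-injective-cyclic {c} {d} (suc n , _ , eq) cd tc≡td = begin
      c              ≡⟨ eq ⟨
      t ((t ^ n) c)  ≡⟨ ^-θ n c ⟨
      (t ^ n) (t c)  ≡⟨ cong (t ^ n) tc≡td ⟩
      (t ^ n) (t d)  ≡⟨ ^-θ n d ⟩
      t ((t ^ n) d)  ≡⟨ common-period (suc n) cd eq ⟩
      d              ∎
      where open ≡-Reasoning

    -- A coincidence between different exponents makes an iterate of `x` cyclic. Then the same
    -- iterate of `y` is cyclic, and all cyclic elements have the same periods.
    ∼⇒kernel⊆ : ∀ {x y} → x ∼ y →
      ∀ m n → (t ^ m) x ≡ (t ^ n) x → (t ^ m) y ≡ (t ^ n) y
    ∼⇒kernel⊆ {x} {y} x∼y m n eq =
      [ (λ m≤n → ordered m≤n eq) , (λ n≤m → sym (ordered n≤m (sym eq))) ]′ (≤-total m n)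
      where
      shifted : ∀ m d → (t ^ m) x ≡ (t ^ (d + m)) x → (t ^ m) y ≡ (t ^ (d + m)) y
      shifted m zero    eq = refl
      shifted m (suc d) eq = sym (trans (^-+ (suc d) m y)
        (common-period (suc d)
          (Equivalence.to (x∼y m) (collision-cyclic m d eq))
          (trans (sym (^-+ (suc d) m x)) (sym eq))))

      ordered : ∀ {m n} → m ≤ n → (t ^ m) x ≡ (t ^ n) x → (t ^ m) y ≡ (t ^ n) y
      ordered {m} {n} m≤n = subst
        (λ k → (t ^ m) x ≡ (t ^ k) x → (t ^ m) y ≡ (t ^ k) y)
        (m∸n+n≡m m≤n) (shifted m (n ∸ m))

    -- The path of any one element of `S` runs through all cyclic elements.
    cyclic∈subalgebra : (S : Subalgebra 𝒜) → ∀ {c} → Cyclic c → c ∈ Subalgebra.member S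
    cyclic∈subalgebra S cyc with Subalgebra.inhabited S
    ... | s , s∈S with reaches-cyclic s cyc
    ... | m , refl = closed-^ S m s∈S

    reaches-subalgebra : (S : Subalgebra 𝒜) → ∀ x → Reaches (Subalgebra.member S) x
    reaches-subalgebra S x =
      let s , s∈S    = Subalgebra.inhabited S
          n , m , eq = connected x s
      in ^⇒reaches n (subst (Subalgebra.member S) (sym eq) (closed-^ S m s∈S))

-- Invariants of isomorphisms.

module Isomorphism {𝒜 ℬ : MonounaryAlgebra ℓ} (f : 𝒜 ≅ ℬ) where
  open _≅_ f
  private
    module 𝒜 = MonounaryAlgebra 𝒜
    module ℬ = MonounaryAlgebra ℬ

  to-injective : Injective _≡_ _≡_ to
  to-injective = ↔-injective bijection

  to-^ : ∀ n x → to ((𝒜.θ 𝒜.^ n) x) ≡ (ℬ.θ ℬ.^ n) (to x)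
  to-^ zero    x = refl
  to-^ (suc n) x = trans (homo _) (cong ℬ.θ (to-^ n x))

  cyclic-⇔ : ∀ x → 𝒜.Cyclic x ⇔ ℬ.Cyclic (to x)
  cyclic-⇔ x = mk⇔
    (λ (n , n≥1 , eq) → n , n≥1 , trans (sym (to-^ n x)) (cong to eq))
    (λ (n , n≥1 , eq) → n , n≥1 , to-injective (trans (to-^ n x) eq))

  θ-⇔ : ∀ x y → 𝒜.θ y ≡ x ⇔ ℬ.θ (to y) ≡ to x
  θ-⇔ x y = mk⇔ (λ eq → trans (sym (homo y)) (cong to eq))
                (λ eq → to-injective (trans (homo y) eq))

  preimage-↔ : ∀ x → 𝒜.Preimage x ↔ ℬ.Preimage (to x)
  preimage-↔ x = refinement-↔ bijection (θ-⇔ x)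

  noncyclicPreimage-↔ : ∀ x → 𝒜.NoncyclicPreimage x ↔ ℬ.NoncyclicPreimage (to x)
  noncyclicPreimage-↔ x = refinement-↔ bijection λ y → mk⇔
    (λ (eq , ¬c) → Equivalence.to (θ-⇔ x y) eq , ¬c ∘ Equivalence.from (cyclic-⇔ y))
    (λ (eq , ¬c) → Equivalence.from (θ-⇔ x y) eq , ¬c ∘ Equivalence.to (cyclic-⇔ y))

  to-∼ : ∀ {x y} → Iterates._∼_ 𝒜 x y → Iterates._∼_ ℬ (to x) (to y)
  to-∼ {x} {y} x∼y k = mk⇔
    (λ c → transport y (Equivalence.to (x∼y k) (untransport x c)))
    (λ c → transport x (Equivalence.from (x∼y k) (untransport y c)))
    where
    transport : ∀ x → 𝒜.Cyclic ((𝒜.θ 𝒜.^ k) x) → ℬ.Cyclic ((ℬ.θ ℬ.^ k) (to x))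
    transport x = subst ℬ.Cyclic (to-^ k x) ∘ Equivalence.to (cyclic-⇔ _)
    untransport : ∀ x → ℬ.Cyclic ((ℬ.θ ℬ.^ k) (to x)) → 𝒜.Cyclic ((𝒜.θ 𝒜.^ k) x)
    untransport x = Equivalence.from (cyclic-⇔ _) ∘ subst ℬ.Cyclic (sym (to-^ k x))

-- Excluded middle, partial bijections and finite covers.

module Classical {ℓ} (em : ExcludedMiddle ℓ) where

  _≟ᶜ_ : {A : Set ℓ} → DecidableEquality A
  x ≟ᶜ y = em

  -- The membership proof is stored irrelevantly, but excluded middle decides the property, so a
  -- proof can be recomputed.
  recall : {A : Set ℓ} {P : Pred A ℓ} (x : Refinement A P) → P (value x)
  recall (_ , [ Px ]) = recompute em Px

  module _ {A B : Set ℓ} {R : A → B → Set ℓ}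
    (functional : ∀ {a b b′} → R a b → R a b′ → b ≡ b′)
    (injective  : ∀ {a a′ b} → R a b → R a′ b → a ≡ a′)
    where
    open Inverse using (to)

    -- Each point of the finite domain is put right by composing with one
    -- transposition, which does not disturb the points treated before.
    extendPartialBijection : A ↔ B → ∀ xs →
      Σ[ k ∈ A ↔ B ] (∀ {a b} → a ∈ˡ xs → R a b → to k a ≡ b)
    extendPartialBijection h [] = h , λ ()
    extendPartialBijection h (x ∷ xs) with extendPartialBijection h xs | em {P = ∃[ y ] R x y}
    ... | k , k-extends | no ¬r = k , λ where
      (here refl) r → contradiction (_ , r) ¬r
      (there a∈)  r → k-extends a∈ r
    ... | k , k-extends | yes (y , r) = transpose-↔ ↔-∘ k , agrees
      where
      open Transposition _≟ᶜ_ (to k x) y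

      agrees : ∀ {a b} → a ∈ˡ (x ∷ xs) → R a b → transpose (to k a) ≡ b
      agrees (here refl) r′ = trans (transpose-left refl) (functional r r′)
      agrees {a} {b} (there a∈) r′ = decide em em
        where
        decide : Dec (to k a ≡ to k x) → Dec (to k a ≡ y) → transpose (to k a) ≡ b
        decide (yes ka≡kx) _ = trans (transpose-left ka≡kx)
          (functional (subst (λ z → R z y) (sym (↔-injective k ka≡kx)) r) r′)
        decide (no ka≢kx) (yes ka≡y) = contradiction
          (cong (to k) (injective r′ (subst (R x) (trans (sym ka≡y) (k-extends a∈ r′)) r)))
          ka≢kx
        decide (no ka≢kx) (no ka≢y) = trans (transpose-other ka≢kx ka≢y) (k-extends a∈ r′)

  Listed : {A : Set ℓ} → Pred A ℓ → Set ℓ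
  Listed P = ∃[ xs ] (∀ {x} → P x → x ∈ˡ xs)

  subsingleton-listed : {A : Set ℓ} {P : Pred A ℓ} →
    (∀ {x y} → P x → P y → x ≡ y) → Listed P
  subsingleton-listed {P = P} unique with em {P = ∃[ x ] P x}
  ... | yes (x , Px) = x ∷ [] , λ Py → here (unique Py Px)
  ... | no ¬P        = [] , λ Py → contradiction (_ , Py) ¬P

  union-listed : {A : Set ℓ} {P Q R : Pred A ℓ} →
    (∀ {x} → R x → P x ⊎ Q x) → Listed P → Listed Q → Listed R
  union-listed R⊆P∪Q (xs , P⊆xs) (ys , Q⊆ys) =
    xs ++ ys , [ ∈-++⁺ˡ ∘ P⊆xs , ∈-++⁺ʳ xs ∘ Q⊆ys ]′ ∘ R⊆P∪Q

  bigUnion-listed : {A I : Set ℓ} {P : I → Pred A ℓ} → (∀ i → Listed (P i)) →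
    ∀ is → Listed (λ x → ∃[ i ] i ∈ˡ is × P i x)
  bigUnion-listed listed [] = [] , λ ()
  bigUnion-listed listed (i ∷ is) = union-listed
    (λ { (_ , here refl , Px) → inj₁ Px ; (j , there j∈ , Px) → inj₂ (j , j∈ , Px) })
    (listed i) (bigUnion-listed listed is)

  -- Monogenic subalgebras and transitivity on elements of equal height.

  module Monogenic (𝒜 : MonounaryAlgebra ℓ) (connected : MonounaryAlgebra.Connected 𝒜) where
    open MonounaryAlgebra 𝒜 renaming (Carrier to A; θ to t)
    open Iterates 𝒜
    open Subalgebra using (algebra; FinitelyGenerated)

    orbit : A → Subalgebra 𝒜
    orbit x = record
      { member    = λ z → ∃[ n ] (t ^ n) x ≡ z
      ; inhabited = x , 0 , refl
      ; closed    = λ (n , eq) → suc n , cong t eq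
      }

    orbit-finitelyGenerated : ∀ x → FinitelyGenerated (orbit x)
    orbit-finitelyGenerated x = x ∷ [] , (λ (n , eq) → generated n eq) , iterate
      where
      generated : ∀ n {z} → (t ^ n) x ≡ z → z ∈ ⟨ _∈ˡ (x ∷ []) ⟩
      generated zero    refl = base (here refl)
      generated (suc n) refl = step (generated n refl)

      iterate : ∀ {z} → z ∈ ⟨ _∈ˡ (x ∷ []) ⟩ → ∃[ n ] (t ^ n) x ≡ z
      iterate (base (here refl)) = 0 , refl
      iterate (step z∈)          = let n , eq = iterate z∈ in suc n , cong t eq

    module _ {x y} (x∼y : x ∼ y) where
      private
        y∼x : y ∼ x
        y∼x k = ⇔-sym (x∼y k)

        kernel : ∀ m n → (t ^ m) x ≡ (t ^ n) x → (t ^ m) y ≡ (t ^ n) y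
        kernel = ∼⇒kernel⊆ connected x∼y

        move : Carrier (algebra (orbit x)) → Carrier (algebra (orbit y))
        move z = let n , _ = recall z in (t ^ n) y , [ n , refl ]

        -- `recall z` yields some exponent, not necessarily `n`; the inclusion of kernels makes the
        -- choice immaterial.
        move-^ : ∀ n z → (t ^ n) x ≡ value z → value (move z) ≡ (t ^ n) y
        move-^ n z eq = let m , eq′ = recall z in kernel m n (trans eq′ (sym eq))

      orbit-≅ : algebra (orbit x) ≅ algebra (orbit y)
      orbit-≅ = record
        { bijection = injective∧surjective⇒↔ move
            (λ {z} {z′} eq →
              let n , eqₙ = recall z
                  m , eqₘ = recall z′
              in value-injective (trans (sym eqₙ)
                   (trans (∼⇒kernel⊆ connected y∼x n m (cong value eq)) eqₘ)))
            (λ w → let n , eq = recall w; z = (t ^ n) x , [ n , refl ] in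
              z , value-injective (trans (move-^ n z refl) eq))
        ; homo = λ z → let n , eq = recall z in
            value-injective (move-^ (suc n) (θ (algebra (orbit x)) z) (cong t eq))
        }

      -- The isomorphism of the orbits matches iterates of `x` and `y` with equal exponents, in
      -- particular at exponent 0.
      ultrahomogeneous⇒transitive : Ultrahomogeneous 𝒜 → Σ[ g ∈ 𝒜 ≅ 𝒜 ] _≅_.to g x ≡ y
      ultrahomogeneous⇒transitive ultra =
        let g , extends = ultra (orbit x) (orbit y)
              (orbit-finitelyGenerated x) (orbit-finitelyGenerated y) orbit-≅
            z = x , [ 0 , refl ]
        in g , trans (extends z) (move-^ 0 z refl)

  -- Extending an isomorphism between subalgebras.

  module Extension (𝒜 : MonounaryAlgebra ℓ) (connected : MonounaryAlgebra.Connected 𝒜)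
    (preimages : ∀ {x y} → Iterates._∼_ 𝒜 x y →
                 MonounaryAlgebra.Preimage 𝒜 x ↔ MonounaryAlgebra.Preimage 𝒜 y)
    (S T : Subalgebra 𝒜) (S-fg : Subalgebra.FinitelyGenerated S)
    (f : Subalgebra.algebra S ≅ Subalgebra.algebra T)
    where
    open MonounaryAlgebra 𝒜 renaming (Carrier to A; θ to t)
    open Iterates 𝒜
    open Inverse using (to; strictlyInverseˡ)
    private
      module S = Subalgebra S
      module T = Subalgebra T
      module f = _≅_ f
      module F = Isomorphism f

    -- A preimage of u in ⟨ g ⟩ is either the cyclic one or the first one on
    -- the path from g.
    preimages∩S-listed : ∀ u → Listed {Preimage u} (λ p → value p ∈ S.member)
    preimages∩S-listed u = union-listed
      {P = Cyclic ∘ value}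
      {Q = λ p → ∃[ g ] g ∈ˡ gens × ¬ Cyclic (value p) × ∃[ n ] (t ^ n) g ≡ value p}
      (λ {p} p∈S → split p (reachable (proj₁ S≐ p∈S)))
      (subsingleton-listed λ {p} {q} cp cq → value-injective
        (θ-injective-cyclic connected cp cq (siblings p q)))
      (bigUnion-listed (λ g → subsingleton-listed
        λ {p} {q} (¬cp , m , eqₘ) (¬cq , n , eqₙ) →
          value-injective (first p q ¬cp ¬cq m n eqₘ eqₙ))
        gens)
      where
      gens = proj₁ S-fg
      S≐   = proj₂ S-fg

      siblings : ∀ (p q : Preimage u) → t (value p) ≡ t (value q)
      siblings p q = trans (recall p) (sym (recall q))

      reachable : ∀ {z} → z ∈ ⟨ _∈ˡ gens ⟩ → ∃[ g ] g ∈ˡ gens × ∃[ n ] (t ^ n) g ≡ z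
      reachable (base z∈) = _ , z∈ , 0 , refl
      reachable (step z∈) = let g , g∈ , n , eq = reachable z∈ in g , g∈ , suc n , cong t eq

      split : ∀ p → (∃[ g ] g ∈ˡ gens × ∃[ n ] (t ^ n) g ≡ value p) →
        Cyclic (value p) ⊎
        (∃[ g ] g ∈ˡ gens × ¬ Cyclic (value p) × ∃[ n ] (t ^ n) g ≡ value p)
      split p (g , g∈ , path) with em {P = Cyclic (value p)}
      ... | yes c = inj₁ c
      ... | no ¬c = inj₂ (g , g∈ , ¬c , path)

      -- The path leads from `t y`, which is also `t z`, to `z` in `d` steps, so `z` comes back to
      -- itself after `suc d`.
      laterCyclic : ∀ {g y z} m d → (t ^ m) g ≡ y → (t ^ (suc m + d)) g ≡ z →
        t y ≡ t z → Cyclic z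
      laterCyclic {g} m d refl refl eq rewrite +-comm m d = suc d , s≤s z≤n , (begin
        t ((t ^ d) ((t ^ (suc d + m)) g))  ≡⟨ ^-θ d _ ⟨
        (t ^ d) (t ((t ^ (suc d + m)) g))  ≡⟨ cong (t ^ d) eq ⟨
        (t ^ d) (t ((t ^ m) g))            ≡⟨ ^-θ d _ ⟩
        t ((t ^ d) ((t ^ m) g))            ≡⟨ ^-+ (suc d) m g ⟨
        (t ^ (suc d + m)) g                ∎)
        where open ≡-Reasoning

      first : ∀ {g} (p q : Preimage u) → ¬ Cyclic (value p) → ¬ Cyclic (value q) →
        ∀ m n → (t ^ m) g ≡ value p → (t ^ n) g ≡ value q → value p ≡ value q
      first p q ¬cp ¬cq m n eqₘ eqₙ with <-cmp m n
      ... | tri≈ _ refl _ = trans (sym eqₘ) eqₙ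
      ... | tri< m<n _ _ with m≤n⇒∃[o]m+o≡n m<n
      ...   | d , refl = contradiction (laterCyclic m d eqₘ eqₙ (siblings p q)) ¬cq
      first p q ¬cp ¬cq m n eqₘ eqₙ | tri> _ _ n<m with m≤n⇒∃[o]m+o≡n n<m
      ...   | d , refl = contradiction (laterCyclic n d eqₙ eqₘ (siblings q p)) ¬cp

    -- An isomorphism preserves and reflects coincidences between iterates, and these determine
    -- which iterates are cyclic.
    f-∼ : ∀ s → value s ∼ value (f.to s)
    f-∼ s k = mk⇔ (kernel⊆⇒cyclic forward k) (kernel⊆⇒cyclic backward k)
      where
      open MonounaryAlgebra S.algebra using () renaming (_^_ to _^ˢ_; θ to tˢ)

      f-^ : ∀ n → value (f.to ((tˢ ^ˢ n) s)) ≡ (t ^ n) (value (f.to s))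
      f-^ n = trans (cong value (F.to-^ n s)) (subalgebra-^ T n (f.to s))

      forward : ∀ m n → (t ^ m) (value s) ≡ (t ^ n) (value s) →
        (t ^ m) (value (f.to s)) ≡ (t ^ n) (value (f.to s))
      forward m n eq = trans (sym (f-^ m)) (trans
        (cong (value ∘ f.to) (value-injective
          (trans (subalgebra-^ S m s) (trans eq (sym (subalgebra-^ S n s))))))
        (f-^ n))

      backward : ∀ m n → (t ^ m) (value (f.to s)) ≡ (t ^ n) (value (f.to s)) →
        (t ^ m) (value s) ≡ (t ^ n) (value s)
      backward m n eq = trans (sym (subalgebra-^ S m s)) (trans
        (cong value (F.to-injective (value-injective
          (trans (f-^ m) (trans eq (sym (f-^ n)))))))
        (subalgebra-^ S n s))

    f-agree : ∀ {s s′} → value s ≡ value s′ → value (f.to s) ≡ value (f.to s′)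
    f-agree eq = cong (value ∘ f.to) (value-injective eq)

    f-injective : ∀ {s s′} → value (f.to s) ≡ value (f.to s′) → value s ≡ value s′
    f-injective eq = cong value (F.to-injective (value-injective eq))

    f-onto : ∀ {y} → y ∈ T.member → ∃[ s ] value (f.to s) ≡ y
    f-onto {y} y∈T = f.from (y , [ y∈T ]) ,
      cong value (strictlyInverseˡ f.bijection (y , [ y∈T ]))

    infix 4 _≈_

    -- The invariant of the construction, relating `u` to a candidate value `v` of the automorphism.
    -- `similar` provides a bijection between the preimages, `extends` keeps to `f` on `S`, and
    -- `reflects` keeps points outside `S` from landing in `T`, on which injectivity relies.
    record _≈_ (u v : A) : Set ℓ where
      field
        similar  : u ∼ v
        reflects : v ∈ T.member → u ∈ S.member
        extends  : (u∈S : u ∈ S.member) → v ≡ value (f.to (u , [ u∈S ]))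

      preserves : u ∈ S.member → v ∈ T.member
      preserves u∈S = subst T.member (sym (extends u∈S)) (recall (f.to (u , [ u∈S ])))

    open _≈_

    f-≈ : ∀ {u} (u∈S : u ∈ S.member) → u ≈ value (f.to (u , [ u∈S ]))
    f-≈ u∈S = record { similar = f-∼ (_ , [ u∈S ]) ; reflects = λ _ → u∈S ; extends = λ _ → refl }

    module _ {u v : A} (u≈v : u ≈ v) where
      private
        -- If `p` lies in `S`, so does `u`, where `v` is the value of `f`; hence `f` maps preimages
        -- of `u` in `S` to preimages of `v`.
        f-preimage : ∀ (p : Preimage u) (p∈S : value p ∈ S.member) →
          t (value (f.to (value p , [ p∈S ]))) ≡ v
        f-preimage p p∈S = trans (cong value (sym (f.homo (value p , [ p∈S ]))))
          (trans (f-agree (recall p))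
            (sym (extends u≈v (subst S.member (recall p) (S.closed p∈S)))))

        graph : Preimage u → Preimage v → Set ℓ
        graph p q = Σ[ p∈S ∈ value p ∈ S.member ] value q ≡ value (f.to (value p , [ p∈S ]))

        extension : Σ[ k ∈ Preimage u ↔ Preimage v ]
          (∀ {p q} → p ∈ˡ proj₁ (preimages∩S-listed u) → graph p q → to k p ≡ q)
        extension = extendPartialBijection
          (λ (_ , eq) (_ , eq′) → value-injective (trans eq (sym eq′)))
          (λ (_ , eq) (_ , eq′) → value-injective (f-injective (trans (sym eq) eq′)))
          (preimages (similar u≈v)) (proj₁ (preimages∩S-listed u))

      φ : Preimage u ↔ Preimage v
      φ = proj₁ extension

      φ-extends : ∀ p (p∈S : value p ∈ S.member) →
        value (to φ p) ≡ value (f.to (value p , [ p∈S ]))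
      φ-extends p p∈S = cong value
        (proj₂ extension {q = _ , [ f-preimage p p∈S ]} (proj₂ (preimages∩S-listed u) p∈S) (p∈S , refl))

      -- If the value lies in `T`, then so does `v`, whence `u` is in `S`. The inverse of `f` now
      -- gives a preimage of `u` in `S` with the same value under `φ`, and injectivity of `φ`
      -- identifies it with `p`.
      φ-reflects : ∀ p → value (to φ p) ∈ T.member → value p ∈ S.member
      φ-reflects p φp∈T = subst S.member
        (cong value (↔-injective φ {s-preimage} {p} (value-injective
          (trans (φ-extends s-preimage (recall s)) fs≡φp))))
        (recall s)
        where
        s = proj₁ (f-onto φp∈T)
        fs≡φp = proj₂ (f-onto φp∈T)

        u∈S : u ∈ S.member
        u∈S = reflects u≈v (subst T.member (recall (to φ p)) (T.closed φp∈T))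

        s-preimage : Preimage u
        s-preimage = value s , [ f-injective {θ S.algebra s} {u , [ u∈S ]}
          (trans (cong value (f.homo s)) (trans (cong t fs≡φp)
            (trans (recall (to φ p)) (extends u≈v u∈S)))) ]

      -- The parents are similar already, so only the cyclicity of `p` and of its value has to be
      -- compared. Inside `S` this is `f-∼`; outside, neither is cyclic, as `S` and `T` contain all
      -- cyclic elements.
      φ-≈ : ∀ p → value p ≈ value (to φ p)
      φ-≈ p = record
        { similar  = ∼-fromParents (cyclic em)
            (subst₂ _∼_ (sym (recall p)) (sym (recall (to φ p))) (similar u≈v))
        ; reflects = φ-reflects p
        ; extends  = φ-extends p
        }
        where
        cyclic : Dec (value p ∈ S.member) → Cyclic (value p) ⇔ Cyclic (value (to φ p))
        cyclic (yes p∈S) = subst (λ z → Cyclic (value p) ⇔ Cyclic z) (sym (φ-extends p p∈S))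
          (f-∼ (value p , [ p∈S ]) 0)
        cyclic (no p∉S) = mk⇔
          (λ c → contradiction (cyclic∈subalgebra connected S c) p∉S)
          (λ c → contradiction (φ-reflects p (cyclic∈subalgebra connected T c)) p∉S)

    -- The decision is an argument, so that later proofs can split on it; `image` supplies `em`.
    extendAt : ∀ {x} → Dec (x ∈ S.member) → (x ∉ S.member → ∃[ v ] t x ≈ v) → ∃[ y ] x ≈ y
    extendAt (yes x∈S) parent = _ , f-≈ x∈S
    extendAt (no  x∉S) parent = _ , φ-≈ (proj₂ (parent x∉S)) (_ , [ refl ])

    image : ∀ {x} → Reaches S.member x → ∃[ y ] x ≈ y
    image (reaches r) = extendAt em (λ x∉S → image (r x∉S))

    -- The value of `g` at `x` recurses through the witness inside that of `x`, while `g (t x)`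
    -- starts from a witness of its own; the two must agree. The equality covers the proof of `_≈_`
    -- as well, since `φ` depends on it.
    image-irrelevant : ∀ {x} (r r′ : Reaches S.member x) → image r ≡ image r′
    image-irrelevant {x} (reaches r) (reaches r′) = decide (em {P = x ∈ S.member})
      where
      decide : ∀ d → extendAt d (λ x∉S → image (r x∉S)) ≡ extendAt d (λ x∉S → image (r′ x∉S))
      decide (yes _)  = refl
      decide (no x∉S) = cong (λ (_ , e) → _ , φ-≈ e (x , [ refl ])) (image-irrelevant (r x∉S) (r′ x∉S))

    g : A → A
    g x = proj₁ (image (reaches-subalgebra connected S x))

    g-≈ : ∀ x → x ≈ g x
    g-≈ x = proj₂ (image (reaches-subalgebra connected S x))

    -- `u` stands for the parent up to equality, so that siblings can be compared through one and
    -- the same bijection `φ (g-≈ u)`.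
    g-above : ∀ {x u} → x ∉ S.member → (tx≡u : t x ≡ u) →
      g x ≡ value (to (φ (g-≈ u)) (x , [ tx≡u ]))
    g-above {x} x∉S refl = go (reaches-subalgebra connected S x)
      where
      go : (r : Reaches S.member x) → proj₁ (image r) ≡ value (to (φ (g-≈ (t x))) (x , [ refl ]))
      go (reaches r) = decide em
        where
        decide : ∀ d → proj₁ (extendAt d (λ x∉S → image (r x∉S)))
          ≡ value (to (φ (g-≈ (t x))) (x , [ refl ]))
        decide (yes x∈S) = contradiction x∈S x∉S
        decide (no  x∉S) = cong (λ (_ , e) → value (to (φ e) (x , [ refl ])))
          (image-irrelevant (r x∉S) (reaches-subalgebra connected S (t x)))

    g-homo : ∀ x → g (t x) ≡ t (g x)
    g-homo x = decide em
      where
      decide : Dec (x ∈ S.member) → g (t x) ≡ t (g x)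
      decide (yes x∈S) = trans (extends (g-≈ (t x)) (S.closed x∈S))
        (trans (cong value (f.homo (x , [ x∈S ]))) (cong t (sym (extends (g-≈ x) x∈S))))
      decide (no x∉S) = trans (sym (recall (to (φ (g-≈ (t x))) (x , [ refl ]))))
        (cong t (sym (g-above x∉S refl)))

    -- Induction along the path from `x` to `S`. The mixed cases are excluded because `g` preserves
    -- and reflects membership. Outside `S` the parents agree by induction, and `φ` over the common
    -- parent is injective.
    g-injective : ∀ {x x′} → Reaches S.member x → g x ≡ g x′ → x ≡ x′
    g-injective {x} {x′} (reaches r) eq = decide em em
      where
      decide : Dec (x ∈ S.member) → Dec (x′ ∈ S.member) → x ≡ x′
      decide (yes x∈S) (yes x′∈S) = f-injective
        (trans (sym (extends (g-≈ x) x∈S)) (trans eq (extends (g-≈ x′) x′∈S)))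
      decide (yes x∈S) (no x′∉S) = contradiction
        (reflects (g-≈ x′) (subst T.member eq (preserves (g-≈ x) x∈S))) x′∉S
      decide (no x∉S) (yes x′∈S) = contradiction
        (reflects (g-≈ x) (subst T.member (sym eq) (preserves (g-≈ x′) x′∈S))) x∉S
      decide (no x∉S) (no x′∉S) = cong value (↔-injective (φ (g-≈ (t x′)))
        (value-injective (trans (sym (g-above x∉S tx≡tx′)) (trans eq (g-above x′∉S refl)))))
        where
        tx≡tx′ : t x ≡ t x′
        tx≡tx′ = g-injective (r x∉S) (trans (g-homo x) (trans (cong t eq) (sym (g-homo x′))))

    -- Induction along the path from `y` to `T`: once the parent of `y` is some `g u`, the bijection
    -- over `u` pulls `y` back.
    g-surjective : ∀ {y} → Reaches T.member y → ∃[ x ] g x ≡ y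
    g-surjective {y} (reaches r) = decide em
      where
      decide : Dec (y ∈ T.member) → ∃[ x ] g x ≡ y
      decide (yes y∈T) = let s , fs≡y = f-onto y∈T in
        value s , trans (extends (g-≈ (value s)) (recall s)) fs≡y
      decide (no y∉T) =
        let u , gu≡ty = g-surjective (r y∉T)
            k         = φ (g-≈ u)
            y′        = y , [ sym gu≡ty ]
            x         = Inverse.from k y′
            kx≡y      = cong value (strictlyInverseˡ k y′)
            -- `g-above` applies outside `S` only; if `x` were in `S`, its value `y` would lie in
            -- `T`.
            x∉S x∈S   = y∉T (subst T.member kx≡y (preserves (φ-≈ (g-≈ u) x) x∈S))
        in value x , trans (g-above x∉S (recall x)) kx≡y

    automorphism : 𝒜 ≅ 𝒜
    automorphism = record
      { bijection = injective∧surjective⇒↔ g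
          (λ {x} → g-injective (reaches-subalgebra connected S x))
          (λ y → g-surjective (reaches-subalgebra connected T y))
      ; homo = g-homo
      }

    automorphism-extends : ∀ x → _≅_.to automorphism (value x) ≡ value (f.to x)
    automorphism-extends x = extends (g-≈ (value x)) (recall x)

  -- Preimage counts by height, and ultrahomogeneity of 𝓑 and 𝓐.

  PreimagesByHeight : MonounaryAlgebra ℓ → Set ℓ
  PreimagesByHeight 𝒜 = ∀ {x y} → x ∼ y → Preimage x ↔ Preimage y
    where
    open MonounaryAlgebra 𝒜
    open Iterates 𝒜

  preimagesByHeight⇒ultrahomogeneous : (𝒜 : MonounaryAlgebra ℓ) →
    MonounaryAlgebra.Connected 𝒜 → PreimagesByHeight 𝒜 → Ultrahomogeneous 𝒜
  preimagesByHeight⇒ultrahomogeneous 𝒜 connected preimages S T S-fg _ f =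
    automorphism , automorphism-extends
    where open Extension 𝒜 connected preimages S T S-fg f

  preimagesByHeight-≅ : {𝒜 ℬ : MonounaryAlgebra ℓ} → 𝒜 ≅ ℬ →
    PreimagesByHeight ℬ → PreimagesByHeight 𝒜
  preimagesByHeight-≅ f preimages {x} {y} x∼y =
    ↔-sym (preimage-↔ y) ↔-∘ (preimages (to-∼ x∼y) ↔-∘ preimage-↔ x)
    where open Isomorphism f

  Is𝓑⇒preimagesByHeight : ∀ {α ℬ} → Is𝓑 α ℬ → PreimagesByHeight ℬ
  Is𝓑⇒preimagesByHeight is𝓑 {x} {y} _ = ↔-sym (∣preimage∣ y) ↔-∘ ∣preimage∣ x
    where open Is𝓑 is𝓑

  module _ {n α} {ℬ : MonounaryAlgebra ℓ} (is𝓐 : Is𝓐[ suc n ⨾ α ] ℬ) where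
    open MonounaryAlgebra ℬ renaming (Carrier to B; θ to t)
    open Iterates ℬ
    open Is𝓐[_⨾_] is𝓐

    private
      c₀ : CyclicElements
      c₀ = Inverse.from ∣cyclic∣ Fin.zero

      -- All heights are finite, because every path reaches `c₀`, which exists as the cycle has
      -- positive length.
      height : ∀ x → ∃[ k ] HasHeight x k
      height x = let m , eq = reaches-cyclic connected x (recall c₀) in
        least (λ _ → em) m (subst Cyclic (sym eq) (recall c₀))

      -- The summand `⊤` stands for the predecessor of `c` on the cycle, its only cyclic preimage by
      -- `θ-injective-cyclic`.
      cyclic-preimage-↔ : ∀ {c} → Cyclic c → (⊤ ⊎ NoncyclicPreimage c) ↔ Preimage c
      cyclic-preimage-↔ {c} cyc@(suc n , _ , eq) =
        injective∧surjective⇒↔ join join-injective join-surjective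
        where
        cyclicPredecessor : Preimage c
        cyclicPredecessor = (t ^ n) c , [ eq ]

        join : ⊤ ⊎ NoncyclicPreimage c → Preimage c
        join = [ (λ _ → cyclicPredecessor) , Refinement.map id proj₁ ]′

        join-injective : Injective _≡_ _≡_ join
        join-injective {inj₁ _} {inj₁ _} _  = refl
        join-injective {inj₁ _} {inj₂ p} eq =
          contradiction (subst Cyclic (cong value eq) (cyclic-^ n cyc)) (proj₂ (recall p))
        join-injective {inj₂ p} {inj₁ _} eq =
          contradiction (subst Cyclic (cong value (sym eq)) (cyclic-^ n cyc)) (proj₂ (recall p))
        join-injective {inj₂ p} {inj₂ q} eq = cong inj₂ (value-injective (cong value eq))

        join-surjective : StrictlySurjective _≡_ join
        join-surjective p with em {P = Cyclic (value p)}
        ... | yes cp = inj₁ _ , value-injective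
              (θ-injective-cyclic connected (cyclic-^ n cyc) cp (trans eq (sym (recall p))))
        ... | no ¬cp = inj₂ (value p , [ recall p , ¬cp ]) , refl

    Is𝓐⇒preimagesByHeight : PreimagesByHeight ℬ
    Is𝓐⇒preimagesByHeight {x} {y} x∼y with height x
    ... | zero , cx , _ =
      -- At height 0 only noncyclic preimages are counted by `is𝓐`, so the cyclic one is split off
      -- on both sides.
      cyclic-preimage-↔ cy
        ↔-∘ ((↔-id _ ⊎-↔ (↔-sym (∣noncyclicPreimage∣ y cy) ↔-∘ ∣noncyclicPreimage∣ x cx))
        ↔-∘ ↔-sym (cyclic-preimage-↔ cx))
      where cy = Equivalence.to (x∼y 0) cx
    ... | suc k , hx =
      ↔-sym (∣preimage∣ y (suc k) (s≤s z≤n) (∼-height x∼y hx))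
        ↔-∘ ∣preimage∣ x (suc k) (s≤s z≤n) hx

  -- Classification of the ultrahomogeneous algebras.

  module Classification (𝒜 : MonounaryAlgebra ℓ)
    (connected : MonounaryAlgebra.Connected 𝒜) (ultra : Ultrahomogeneous 𝒜) where
    open MonounaryAlgebra 𝒜 renaming (Carrier to A; θ to t)
    open Iterates 𝒜
    open Monogenic 𝒜 connected

    preimages : PreimagesByHeight 𝒜
    preimages {x} x∼y with ultrahomogeneous⇒transitive x∼y ultra
    ... | g , refl = Isomorphism.preimage-↔ g x

    noncyclicPreimages : ∀ {x y k} → HasHeight x k → HasHeight y k →
      NoncyclicPreimage x ↔ NoncyclicPreimage y
    noncyclicPreimages {x} hx hy with ultrahomogeneous⇒transitive (heights⇒∼ hx hy) ultra
    ... | g , refl = Isomorphism.noncyclicPreimage-↔ g x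

    noncyclic⇒Is𝓑 : (∀ x → ¬ Cyclic x) → ∃[ α ] Is𝓑 α 𝒜
    noncyclic⇒Is𝓑 ¬cyc =
      -- `t nonempty` has `nonempty` among its preimages, so this cardinal is nonzero. Without
      -- cyclic elements any two elements are similar, so one element fixes the cardinal.
      record { ∣_∣ = Preimage (t nonempty) ; nonzero = nonempty , [ refl ] } ,
      record
        { connected  = connected
        ; noncyclic  = ¬cyc
        ; ∣preimage∣ = λ x → preimages (∼-noncyclic ¬cyc x _)
        }

    Inhabited : ℕ → Set ℓ
    Inhabited k = ∃[ y ] HasHeight y k

    -- Only meaningful when there are elements of height suc k.
    cardinalAt : ∀ {k} → Dec (Inhabited (suc k)) → NonzeroCardinal ℓ
    cardinalAt (yes (y , h)) = record
      { ∣_∣ = NoncyclicPreimage (t y) ; nonzero = y , [ refl , height-noncyclic h ] }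
    cardinalAt (no _) = record { ∣_∣ = A ; nonzero = nonempty }

    cardinal : ℕ → NonzeroCardinal ℓ
    cardinal k = cardinalAt {k} em

    cardinal-correct : ∀ {x k} → Inhabited (suc k) → HasHeight x k →
      NoncyclicPreimage x ↔ ∣ cardinal k ∣
    cardinal-correct {x} {k} inh hx = correct em
      where
      correct : (d : Dec (Inhabited (suc k))) → NoncyclicPreimage x ↔ ∣ cardinalAt d ∣
      correct (yes (y , hy)) = noncyclicPreimages hx (height-θ hy)
      correct (no ¬inh)      = contradiction inh ¬inh

    -- The list stops at the least `h` such that height `suc h` does not occur, and is infinite if
    -- there is none. By minimality the default in `cardinalAt` never enters the list. From `h` on
    -- there is nothing to count, as the heights that occur are closed downwards.
    cardinals : Σ[ α ∈ CardinalList ℓ ]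
      (∀ x k → HasHeight x k → NoncyclicPreimage x ↔ entry α k)
    cardinals with em {P = ∃[ h ] ¬ Inhabited (suc h)}
    ... | no unbounded = infinite cardinal , λ x k →
      cardinal-correct (decidable-stable em (λ ¬inh → unbounded (k , ¬inh)))
    ... | yes (n , bound) with least (λ _ → em) n bound
    ...   | h , empty , minimal = finite (applyUpTo cardinal h) , counts
      where
      counts : ∀ x k → HasHeight x k →
        NoncyclicPreimage x ↔ entry (finite (applyUpTo cardinal h)) k
      counts x k hx with k <? h
      ... | yes k<h = subst (NoncyclicPreimage x ↔_) (sym (entry-applyUpTo-< cardinal k<h))
        (cardinal-correct (decidable-stable em (minimal k k<h)) hx)
      ... | no k≮h = subst (NoncyclicPreimage x ↔_) (sym (entry-applyUpTo-≥ cardinal (≮⇒≥ k≮h)))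
        (mk↔ₛ′ (⊥-elim ∘ none) (λ ()) (λ ()) (⊥-elim ∘ none))
        where
        none : ¬ NoncyclicPreimage x
        -- A noncyclic preimage of `x` has height `suc k`; `k ∸ h` applications of `t` bring it down
        -- to the missing height `suc h`.
        none p = empty (height-downward (k ∸ h)
          (subst (HasHeight (value p))
            (trans (cong suc (sym (m∸n+n≡m (≮⇒≥ k≮h)))) (sym (+-suc (k ∸ h) h)))
            (height-preimage
              (subst (λ z → HasHeight z k) (sym (proj₁ (recall p))) hx)
              (proj₂ (recall p)))))

    -- Cyclic elements have cyclic images, so an element of positive height has no cyclic preimages.
    preimage-↔-noncyclicPreimage : ∀ {x k} → HasHeight x (suc k) →
      Preimage x ↔ NoncyclicPreimage x
    preimage-↔-noncyclicPreimage hx = refinement-↔ (↔-id _) λ y → mk⇔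
      (λ eq → eq , λ c → height-noncyclic hx (subst Cyclic eq (cyclic-^ 1 c)))
      proj₁

    module _ {c : A} (cyc : Cyclic c) where

      -- The search starts at 0, so `n ≥ 1` belongs to the property that is minimised; otherwise the
      -- result would be 0.
      period : ∃[ n ] (n ≥ 1 × (t ^ n) c ≡ c) × (∀ j → j < n → ¬ (j ≥ 1 × (t ^ j) c ≡ c))
      period = least (λ _ → em) (proj₁ cyc) (proj₂ cyc)

      cyclicElements-↔ : CyclicElements ↔ Fin (proj₁ period)
      cyclicElements-↔ with period
      ... | n , (n≥1 , eq) , minimal = ↔-sym (injective∧surjective⇒↔ power
              (λ {i} {j} → power-injective i j) power-surjective)
        where
        power : Fin n → CyclicElements
        power i = (t ^ toℕ i) c , [ cyclic-^ (toℕ i) cyc ]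

        -- An equality would give `(t ^ i) c` the period `suc d`. By `common-period`, `c` would have
        -- it too, against the minimality of `n`, as `suc d ≤ suc i + d < n`.
        distinct : ∀ i d → suc i + d < n → (t ^ i) c ≢ (t ^ (suc i + d)) c
        distinct i d lt eqᵢ = minimal (suc d) (≤-<-trans (s≤s (m≤n+m d i)) lt)
          (s≤s z≤n , common-period connected (suc d) cyc (begin
            (t ^ suc d) ((t ^ i) c)  ≡⟨ ^-+ (suc d) i c ⟨
            (t ^ (suc d + i)) c      ≡⟨ cong (λ k → (t ^ suc k) c) (+-comm d i) ⟩
            (t ^ (suc i + d)) c      ≡⟨ eqᵢ ⟨
            (t ^ i) c                ∎))
          where open ≡-Reasoning

        power-injective : ∀ i j → power i ≡ power j → i ≡ j
        power-injective i j eqᵢⱼ with <-cmp (toℕ i) (toℕ j)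
        ... | tri≈ _ i≡j _ = toℕ-injective i≡j
        ... | tri< i<j _ _ = let d , eq = m≤n⇒∃[o]m+o≡n i<j in contradiction
          (trans (cong value eqᵢⱼ) (cong (λ k → (t ^ k) c) (sym eq)))
          (distinct (toℕ i) d (subst (_< n) (sym eq) (toℕ<n j)))
        ... | tri> _ _ j<i = let d , eq = m≤n⇒∃[o]m+o≡n j<i in contradiction
          (trans (cong value (sym eqᵢⱼ)) (cong (λ k → (t ^ k) c) (sym eq)))
          (distinct (toℕ j) d (subst (_< n) (sym eq) (toℕ<n i)))

        power-surjective : StrictlySurjective _≡_ power
        power-surjective y =
          fromℕ< (m%n<n m n) , value-injective (begin
            (t ^ toℕ (fromℕ< (m%n<n m n))) c      ≡⟨ cong (λ k → (t ^ k) c) (toℕ-fromℕ< (m%n<n m n)) ⟩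
            (t ^ (m % n)) c                       ≡⟨ cong (t ^ (m % n)) (period-* (m / n) n eq) ⟨
            (t ^ (m % n)) ((t ^ (m / n * n)) c)   ≡⟨ ^-+ (m % n) (m / n * n) c ⟨
            (t ^ (m % n + m / n * n)) c           ≡⟨ cong (λ k → (t ^ k) c) (m≡m%n+[m/n]*n m n) ⟨
            (t ^ m) c                             ≡⟨ tᵐc≡y ⟩
            value y                               ∎)
          where
          open ≡-Reasoning
          instance
            n≢0 : NonZero n
            n≢0 = >-nonZero n≥1
          m = proj₁ (reaches-cyclic connected c (recall y))
          tᵐc≡y = proj₂ (reaches-cyclic connected c (recall y))

      cyclic⇒Is𝓐 : ∃[ n ] n ≥ 1 × (∃[ α ] Is𝓐[ n ⨾ α ] 𝒜)
      cyclic⇒Is𝓐 = let α , counts = cardinals in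
        proj₁ period , proj₁ (proj₁ (proj₂ period)) , α , record
          { connected           = connected
          ; ∣cyclic∣            = cyclicElements-↔
          ; ∣noncyclicPreimage∣ = λ x cx → counts x 0 (cyclic⇒height0 cx)
          ; ∣preimage∣          = λ { x (suc k) _ hx →
              counts x (suc k) hx ↔-∘ preimage-↔-noncyclicPreimage hx }
          }

theorem4p9 : ∀ {ℓ} → ExcludedMiddle ℓ →
    (𝒜 : MonounaryAlgebra ℓ) → MonounaryAlgebra.Connected 𝒜 →
    Ultrahomogeneous 𝒜 ⇔
    ( (∃[ α ] ∃[ ℬ ] Is𝓑 α ℬ × 𝒜 ≅ ℬ)
    ⊎ (∃[ n ] n ≥ 1 × (∃[ α ] ∃[ ℬ ] Is𝓐[ n ⨾ α ] ℬ × 𝒜 ≅ ℬ)) )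
theorem4p9 {ℓ} em 𝒜 connected = mk⇔ classify λ where
    (inj₁ (_ , _ , is𝓑 , iso)) →
      homogeneous (preimagesByHeight-≅ iso (Is𝓑⇒preimagesByHeight is𝓑))
    (inj₂ (suc _ , _ , _ , _ , is𝓐 , iso)) →
      homogeneous (preimagesByHeight-≅ iso (Is𝓐⇒preimagesByHeight is𝓐))
  where
  open Classical em
  open MonounaryAlgebra 𝒜 using (Cyclic)

  homogeneous : PreimagesByHeight 𝒜 → Ultrahomogeneous 𝒜
  homogeneous = preimagesByHeight⇒ultrahomogeneous 𝒜 connected

  classify : Ultrahomogeneous 𝒜 →
      (∃[ α ] ∃[ ℬ ] Is𝓑 α ℬ × 𝒜 ≅ ℬ)
    ⊎ (∃[ n ] n ≥ 1 × (∃[ α ] ∃[ ℬ ] Is𝓐[ n ⨾ α ] ℬ × 𝒜 ≅ ℬ))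
  classify ultra with em {P = ∃[ c ] Cyclic c}
  ... | yes (c , cyc) =
    -- The algebras on the right are specified by their properties, so `𝒜` itself serves as the
    -- witness, with the identity isomorphism.
    let n , n≥1 , α , is𝓐 = cyclic⇒Is𝓐 cyc in inj₂ (n , n≥1 , α , 𝒜 , is𝓐 , ≅-refl)
    where open Classification 𝒜 connected ultra
  ... | no ¬cyc =
    let α , is𝓑 = noncyclic⇒Is𝓑 (λ x cx → ¬cyc (x , cx)) in inj₁ (α , 𝒜 , is𝓑 , ≅-refl)
    where open Classification 𝒜 connected ultra
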